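{- Algorithm 1 (defined in the context) exhibits unbounded robustness for the preemptive FIFO buffer management problem; that is, there is no finite $\beta$ for which it is $\beta$-robust, where $\beta$-robust means $$\sup_{\sigma,\hat\sigma}\ \frac{v(\mathrm{OPT}(\sigma))}{v(\mathrm{ALG}(\sigma,\hat\sigma))}\le\beta$$ and $\mathrm{ALG}(\sigma,\hat\sigma)$ is the schedule of Algorithm 1 on actual input $\sigma$ and (arbitrary) predicted input $\hat\sigma$.
   Context: Preemptive FIFO buffer management. A buffer has fixed finite capacity. Time is discrete, $i\in\{1,\dots,T\}$. An input is $\sigma=(\sigma_1,\dots,\sigma_T)$, where $\sigma_i=(p_{i_1},\dots,p_{i_k})$, $k\in\mathbb{Z}_+$, is the sequence of packets arriving at step $i$; each packet $p$ has a nonnegative real value $v(p)$. Each step has two phases. Arrival phase: for each arriving packet in turn, the algorithm immediately accepts or drops it, and it may preempt (permanently discard) any packets in the buffer; an accepted packet is placed at the tail of the buffer, and the capacity may never be exceeded. Transmission phase: after all arrivals of the step, the packet at the head of the buffer (if any) is transmitted and its value is gained. Notation. A schedule is the set of packets transmitted; its value $v(\cdot)$ is the sum of their values. $\mathrm{OPT}(\sigma)$ is an offline optimal schedule (maximum total transmitted value) for $\sigma$. A prediction $\hat\sigma$ is a sequence of the same form as $\sigma$, known to the algorithm in advance; $\sigma$ is revealed online. Algorithm 1 (input: $\sigma$, $\hat\sigma$). Compute an offline optimal schedule $\mathrm{OPT}(\hat\sigma)$ for the prediction. For each step $i=1,\dots,T$: process the arrivals $\sigma_i$ identically to $\mathrm{OPT}(\hat\sigma)$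 (same accept/drop/preempt decisions), then transmit the head packet of the buffer. -}

module Defs where

open import Level using (Level; suc; _⊔_)
open import Algebra.Bundles using (CommutativeRing)
open import Data.Bool.Base using (Bool; not; _∧_; if_then_else_)
open import Data.List.Base using (List; []; _∷_; _++_; _∷ʳ_; length; filterᵇ; take; drop; foldr)
open import Data.Nat.Base as ℕ using (ℕ; _<ᵇ_)
open import Data.Product.Base using (_×_; _,_)
open import Data.Vec.Base using (Vec; []; _∷_)
open import Relation.Binary.Core using (Rel)
open import Relation.Binary.Structures using (IsTotalOrder)
open import Relation.Nullary.Negation.Core using (¬_)

-- The standard library has no real numbers, so packet values and β are taken
-- from an arbitrary ordered field; ℝ is the intended instance.
record OrderedField c ℓ₁ ℓ₂ : Set (suc (c ⊔ ℓ₁ ⊔ ℓ₂)) where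
  infix 4 _≤_
  field
    commutativeRing : CommutativeRing c ℓ₁
  open CommutativeRing commutativeRing public
  field
    0≉1          : ¬ (0# ≈ 1#)
    inverse      : ∀ x → ¬ (x ≈ 0#) → Carrier
    *-inverseʳ   : ∀ x (x≉0 : ¬ (x ≈ 0#)) → x * inverse x x≉0 ≈ 1#
    _≤_          : Rel Carrier ℓ₂
    isTotalOrder : IsTotalOrder _≈_ _≤_
    +-monoˡ-≤    : ∀ z {x y} → x ≤ y → x + z ≤ y + z
    *-nonNeg     : ∀ {x y} → 0# ≤ x → 0# ≤ y → 0# ≤ x * y

  divide : ∀ x y → ¬ (y ≈ 0#) → Carrier
  divide x y y≉0 = x * inverse y y≉0

-- B is the capacity of the buffer.
module Buffering {c ℓ₁ ℓ₂ : Level} (F : OrderedField c ℓ₁ ℓ₂) (B : ℕ) where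

  open OrderedField F

  record Packet : Set (c ⊔ ℓ₂) where
    constructor packet
    field
      val    : Carrier
      nonNeg : 0# ≤ val

  Input : ℕ → Set (c ⊔ ℓ₂)
  Input T = Vec (List Packet) T

  -- (i , j) is the j-th arrival of step i, both counted from 0. Packets of
  -- equal value are told apart by their slots.
  Slot : Set
  Slot = ℕ × ℕ

  record Entry : Set (c ⊔ ℓ₂) where
    constructor entry
    field
      slot : Slot
      pkt  : Packet

  -- The head of the list is the head of the queue.
  Buffer : Set (c ⊔ ℓ₂)
  Buffer = List Entry

  -- Slots determine entries within a run and each is transmitted at most once,
  -- so the list of transmitted entries represents a set.
  Schedule : Set (c ⊔ ℓ₂)
  Schedule = List Entry

  v : Schedule → Carrier
  v = foldr (λ e s → Packet.val (Entry.pkt e) + s) 0#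

  -- What to do when a packet arrives: which packets to preempt, and whether to
  -- accept the arriving one.
  record Decision : Set where
    field
      preempt : Slot → Bool
      accept  : Bool

  Plan : Set
  Plan = Slot → Decision

  -- A packet to be accepted is dropped if the buffer is still full after the
  -- preemptions. Hence every plan respects the capacity, on every input.
  arrive : Decision → Entry → Buffer → Buffer
  arrive d e b =
    if Decision.accept d ∧ (length kept <ᵇ B) then kept ∷ʳ e else kept
    where
    kept : Buffer
    kept = filterᵇ (λ e′ → not (Decision.preempt d (Entry.slot e′))) b

  arrivals : Plan → (i j : ℕ) → List Packet → Buffer → Buffer
  arrivals π i j []       b = b
  arrivals π i j (p ∷ ps) b =
    arrivals π i (ℕ.suc j) ps (arrive (π (i , j)) (entry (i , j) p) b)

  runFrom : ∀ {T} → Plan → ℕ → Input T → Buffer → Schedule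
  runFrom π i []       b = []
  runFrom π i (ps ∷ σ) b = take 1 b′ ++ runFrom π (ℕ.suc i) σ (drop 1 b′)
    where
    b′ : Buffer
    b′ = arrivals π i 0 ps b

  run : ∀ {T} → Plan → Input T → Schedule
  run π σ = runFrom π 0 σ []

  -- A way of computing offline optimal schedules. Optimal plans are not unique;
  -- a solver fixes a choice among them.
  record OfflineSolver : Set (c ⊔ ℓ₂) where
    field
      plan    : ∀ {T} → Input T → Plan
      optimal : ∀ {T} (σ : Input T) (π : Plan) → v (run π σ) ≤ v (run (plan σ) σ)

  OPT : OfflineSolver → ∀ {T} → Input T → Schedule
  OPT S σ = run (OfflineSolver.plan S σ) σ

  -- The decisions taken for the predicted packets are repeated, slot by slot, on
  -- the actual packets. When σ and σ̂ have different numbers of arrivals, this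
  -- alone does not determine what happens to unpredicted packets. Optimality for
  -- σ̂ leaves the plan unconstrained at their slots, so a solver may prescribe
  -- anything there, for instance to drop them.
  algorithm1 : OfflineSolver → ∀ {T} → (σ σ̂ : Input T) → Schedule
  algorithm1 S σ σ̂ = run (OfflineSolver.plan S σ̂) σ

  -- The supremum is at most β iff every ratio is. Pairs with v (ALG σ σ̂) ≈ 0#,
  -- where the ratio is undefined, impose no condition; reading x / 0 as ∞
  -- would only make robustness harder to achieve.
  Robust : OfflineSolver → (∀ {T} → (σ σ̂ : Input T) → Schedule) →
           Carrier → Set (c ⊔ ℓ₁ ⊔ ℓ₂)
  Robust S ALG β =
    ∀ {T} (σ σ̂ : Input T) (ALG≉0 : ¬ (v (ALG σ σ̂) ≈ 0#)) →
    divide (v (OPT S σ)) (v (ALG σ σ̂)) ALG≉0 ≤ β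

-- A plan refers to packets only by their slots, so it cannot see that a value
-- was mispredicted. Predict a single step with packets of values 1, 0: every
-- optimal plan transmits the first one. If the actual values are 1, M, the same
-- plan still gains 1, while M is attainable.
module Submission where

open import Defs
open import Data.Bool.Base using (true; false)
open import Data.List.Base using ([]; _∷_)
open import Data.Nat.Base using (ℕ; suc; NonZero; _≡ᵇ_; _<ᵇ_)
open import Data.Product.Base using (∃; _×_; _,_)
open import Data.Sum.Base using (_⊎_; inj₁; inj₂)
open import Data.Vec.Base using ([]; _∷_)
open import Relation.Binary.PropositionalEquality.Core as ≡ using (_≡_)
open import Relation.Binary.Structures using (IsTotalOrder)
open import Relation.Nullary.Negation.Core using (¬_; contradiction)
import Algebra.Properties.Ring as RingProperties

module OrderedFieldProperties {c ℓ₁ ℓ₂} (F : OrderedField c ℓ₁ ℓ₂) where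

  open OrderedField F
  open IsTotalOrder isTotalOrder public
    using (total; antisym; ≤-respˡ-≈; ≤-respʳ-≈)
    renaming (refl to ≤-refl; trans to ≤-trans)
  open RingProperties ring using (-1*x≈-x; -‿involutive)

  0≤1 : 0# ≤ 1#
  0≤1 with total 0# 1#
  ... | inj₁ 0≤1 = 0≤1
  ... | inj₂ 1≤0 = ≤-respʳ-≈ [-1]²≈1 (*-nonNeg 0≤-1 0≤-1)
    where
    0≤-1 : 0# ≤ - 1#
    0≤-1 = ≤-respˡ-≈ (-‿inverseʳ 1#) (≤-respʳ-≈ (+-identityˡ (- 1#)) (+-monoˡ-≤ (- 1#) 1≤0))

    [-1]²≈1 : - 1# * - 1# ≈ 1#
    [-1]²≈1 = trans (-1*x≈-x (- 1#)) (-‿involutive 1#)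

  1≰0 : ¬ (1# ≤ 0#)
  1≰0 1≤0 = 0≉1 (antisym 0≤1 1≤0)

  1+x≰x : ∀ x → ¬ (1# + x ≤ x)
  1+x≰x x 1+x≤x = 1≰0 (≤-respˡ-≈ 1+x-x≈1 (≤-respʳ-≈ (-‿inverseʳ x) (+-monoˡ-≤ (- x) 1+x≤x)))
    where
    1+x-x≈1 : (1# + x) + - x ≈ 1#
    1+x-x≈1 = trans (+-assoc 1# x (- x)) (trans (+-congˡ (-‿inverseʳ x)) (+-identityʳ 1#))

  nonNeg-unbounded : ∀ x → ∃ λ y → 0# ≤ y × ¬ (y ≤ x)
  nonNeg-unbounded x with total 0# x
  ... | inj₁ 0≤x = 1# + x ,
    ≤-trans 0≤x (≤-respˡ-≈ (+-identityˡ x) (+-monoˡ-≤ x 0≤1)) , 1+x≰x x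
  ... | inj₂ x≤0 = 1# , 0≤1 , λ 1≤x → 1≰0 (≤-trans 1≤x x≤0)

  divide-by-1 : ∀ x {y} (y≉0 : ¬ (y ≈ 0#)) → y ≈ 1# → divide x y y≉0 ≈ x
  divide-by-1 x {y} y≉0 y≈1 = trans (*-congˡ y⁻¹≈1) (*-identityʳ x)
    where
    y⁻¹≈1 : inverse y y≉0 ≈ 1#
    y⁻¹≈1 = trans (sym (*-identityˡ _)) (trans (*-congʳ (sym y≈1)) (*-inverseʳ y y≉0))

module TwoPackets {c ℓ₁ ℓ₂} (F : OrderedField c ℓ₁ ℓ₂) (n : ℕ) where

  open OrderedField F
  open OrderedFieldProperties F
  open Buffering F (suc n)
  open Packet using (val)

  twoPackets : Packet → Packet → Input 1
  twoPackets p q = (p ∷ q ∷ []) ∷ []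

  TransmitsFirst : Plan → Set _
  TransmitsFirst π = ∀ p q → v (run π (twoPackets p q)) ≡ val p + 0#

  TransmitsSecond : Plan → Set _
  TransmitsSecond π = ∀ p q → v (run π (twoPackets p q)) ≡ val q + 0#

  TransmitsNothing : Plan → Set _
  TransmitsNothing π = ∀ p q → v (run π (twoPackets p q)) ≡ 0#

  transmission : ∀ π → TransmitsFirst π ⊎ TransmitsSecond π ⊎ TransmitsNothing π
  -- The scrutinees are nested because each occurs in the normal form of the goal
  -- only after the previous one has been resolved.
  transmission π with Decision.accept (π (0 , 0))
  transmission π | false with Decision.accept (π (0 , 1))
  ... | false = inj₂ (inj₂ λ _ _ → ≡.refl)
  ... | true  = inj₂ (inj₁ λ _ _ → ≡.refl)
  transmission π | true with Decision.preempt (π (0 , 1)) (0 , 0)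
  transmission π | true | true with Decision.accept (π (0 , 1))
  ... | false = inj₂ (inj₂ λ _ _ → ≡.refl)
  ... | true  = inj₂ (inj₁ λ _ _ → ≡.refl)
  transmission π | true | false with Decision.accept (π (0 , 1))
  ... | false = inj₁ λ _ _ → ≡.refl
  ... | true with 0 <ᵇ n
  ...   | false = inj₁ λ _ _ → ≡.refl
  ...   | true  = inj₁ λ _ _ → ≡.refl

  acceptOnly : ℕ → Plan
  acceptOnly k (_ , j) = record { preempt = λ _ → false ; accept = j ≡ᵇ k }

  zeroPacket onePacket : Packet
  zeroPacket = packet 0# ≤-refl
  onePacket  = packet 1# 0≤1

  module _ (S : OfflineSolver) where

    open OfflineSolver S

    optimal-transmitsFirst : TransmitsFirst (plan (twoPackets onePacket zeroPacket))
    optimal-transmitsFirst = go (transmission π)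
      where
      σ̂ : Input 1
      σ̂ = twoPackets onePacket zeroPacket

      π : Plan
      π = plan σ̂

      1≤OPT : 1# ≤ v (run π σ̂)
      1≤OPT = ≤-respˡ-≈ (+-identityʳ 1#) (optimal σ̂ (acceptOnly 0))

      go : TransmitsFirst π ⊎ TransmitsSecond π ⊎ TransmitsNothing π → TransmitsFirst π
      go (inj₁ first)          = first
      go (inj₂ (inj₁ second))  = contradiction
        (≤-respʳ-≈ (trans (reflexive (second _ _)) (+-identityʳ 0#)) 1≤OPT) 1≰0
      go (inj₂ (inj₂ nothing)) = contradiction
        (≤-respʳ-≈ (reflexive (nothing _ _)) 1≤OPT) 1≰0

    second≤OPT : ∀ p q → val q ≤ v (OPT S (twoPackets p q))
    second≤OPT p q =
      ≤-respˡ-≈ (+-identityʳ (val q)) (optimal (twoPackets p q) (acceptOnly 1))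

    algorithm1-not-robust : ∀ β → ¬ Robust S (algorithm1 S) β
    algorithm1-not-robust β robust with nonNeg-unbounded β
    ... | M , 0≤M , M≰β = M≰β (≤-trans (second≤OPT onePacket (packet M 0≤M)) OPT≤β)
      where
      σ σ̂ : Input 1
      σ = twoPackets onePacket (packet M 0≤M)
      σ̂ = twoPackets onePacket zeroPacket

      ALG≈1 : v (algorithm1 S σ σ̂) ≈ 1#
      ALG≈1 = trans (reflexive (optimal-transmitsFirst _ _)) (+-identityʳ 1#)

      ALG≉0 : ¬ (v (algorithm1 S σ σ̂) ≈ 0#)
      ALG≉0 ALG≈0 = 0≉1 (trans (sym ALG≈0) ALG≈1)

      OPT≤β : v (OPT S σ) ≤ β
      OPT≤β = ≤-respˡ-≈ (divide-by-1 _ ALG≉0 ALG≈1) (robust σ σ̂ ALG≉0)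

theorem9 : ∀ {c ℓ₁ ℓ₂} (F : OrderedField c ℓ₁ ℓ₂) (B : ℕ) .{{_ : NonZero B}}
    (S : Buffering.OfflineSolver F B) →
    ¬ (∃ λ β → Buffering.Robust F B S (Buffering.algorithm1 F B S) β)
theorem9 F (suc n) S (β , robust) = TwoPackets.algorithm1-not-robust F n S β robust
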